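{- Let $n\ge 3$ and let $\mathcal{F}$ be a family of subsets of $[n]=\{1,\dots,n\}$. Assume that there are no 3 different sets $A,B,C\in\mathcal{F}$ such that either (a) $A\subset B$, $A\subset C$ and $|B|=|C|$, or (b) $B\subset A$, $C\subset A$ and $|B|=|C|$. Then $|\mathcal{F}|\le 2\binom{n-1}{\lfloor\frac{n-1}{2}\rfloor}$. -}

module Defs where

open import Data.Nat using (ℕ)
open import Data.Fin.Subset using (Subset; _⊂_; ∣_∣)
open import Data.List using (List)
open import Data.List.Membership.Propositional using (_∈_)
open import Data.Product using (_×_)
open import Data.Sum using (_⊎_)
open import Relation.Binary.PropositionalEquality using (_≡_; _≢_)
open import Relation.Nullary using (¬_)

Forbidden : {n : ℕ} → Subset n → Subset n → Subset n → Set
Forbidden A B C =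
  A ≢ B × A ≢ C × B ≢ C ×
  ((A ⊂ B × A ⊂ C × ∣ B ∣ ≡ ∣ C ∣) ⊎ (B ⊂ A × C ⊂ A × ∣ B ∣ ≡ ∣ C ∣))

-- The family 𝓕 (given as a duplicate-free list) contains no forbidden triple.
NoForbidden : {n : ℕ} → List (Subset n) → Set
NoForbidden F = ∀ {A B C} → A ∈ F → B ∈ F → C ∈ F → ¬ Forbidden A B C

{-# OPTIONS --safe #-}
module Submission where

-- For n = 2m with ∅ and [n] not in 𝓕, give mass 1 to every member of size ≤ m and push it up level
-- by level, a set X of size k sending 1/(n−k−1) of its mass to each covering set outside 𝓕. A set
-- carrying mass contains a member, so by (a) at most one of its n−k covers is a member and no mass
-- is lost; as a set of size k+1 ≤ m has only k+1 subsets to receive from, no mass exceeds 1. Push the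
-- members of size ≥ m down in the same way. If a middle set outside 𝓕 receives from both sides, it
-- lies between two members, so by (a) and (b) members on each level below (above) it are unique, and
-- it receives at most 1/2 from each side. Comparing totals on the middle level gives |𝓕| ≤ C(2m,m).
-- If ∅ or [n] is a member, every level has at most one member. For n = 2m+1 split 𝓕 by one
-- element: one half misses ∅, the other its full set, and either alone suffices for the bound C(2m,m).

open import Defs
open import Data.Bool using (if_then_else_)
import Data.Bool.Properties as Bool
open import Data.Empty using (⊥-elim)
open import Data.Fin.Subset using (Subset; inside; outside; _⊆_; _⊂_; ∣_∣; ∁; ⊤; ⊥)
open import Data.Fin.Subset.Properties hiding (_∈?_)
open import Data.List using (List; []; _∷_; length)
open import Data.List.Membership.Propositional using (_∈_)
import Data.List.Membership.DecPropositional as DecMembership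
open import Data.List.Relation.Unary.All using (lookup)
open import Data.List.Relation.Unary.AllPairs using ([]; _∷_)
open import Data.List.Relation.Unary.Unique.Propositional using (Unique)
open import Data.Nat
open import Data.Nat.Combinatorics using (_C_; nCk≡nC[n∸k]; nCk+nC[k+1]≡[n+1]C[k+1])
open import Data.Nat.Properties
open import Data.Nat.Tactic.RingSolver using (solve-∀)
open import Data.Product using (_×_; _,_; ∃; proj₁; proj₂)
open import Data.Sum using (_⊎_; inj₁; inj₂)
open import Data.Vec using ([]; _∷_; here)
open import Data.Vec.Properties using (≡-dec)
open import Function using (_∘_)
open import Level using (0ℓ)
open import Relation.Binary.PropositionalEquality
open import Relation.Nullary
open import Relation.Nullary.Decidable using (map′; _×-dec_; dec-true; dec-false)
open import Relation.Unary using (Pred; Decidable)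

private variable
  n : ℕ
  A B : Set

-- Indicators of decidable propositions.

_≟ₛ_ : (S T : Subset n) → Dec (S ≡ T)
_≟ₛ_ = ≡-dec Bool._≟_

ι : Dec A → ℕ
ι a = if does a then 1 else 0

ι-yes : (a : Dec A) → A → ι a ≡ 1
ι-yes (yes _) _ = refl
ι-yes (no ¬a) a = ⊥-elim (¬a a)

ι-no : (a : Dec A) → ¬ A → ι a ≡ 0
ι-no (yes a) ¬a = ⊥-elim (¬a a)
ι-no (no _)  _  = refl

ι-mono : (a : Dec A) (b : Dec B) → (A → B) → ι a ≤ ι b
ι-mono (no _)  b f = z≤n
ι-mono (yes a) b f = ≤-reflexive (sym (ι-yes b (f a)))

ι-cong : (a : Dec A) (b : Dec B) → (A → B) → (B → A) → ι a ≡ ι b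
ι-cong a b f g = ≤-antisym (ι-mono a b f) (ι-mono b a g)

ι≤1 : (a : Dec A) → ι a ≤ 1
ι≤1 (yes _) = ≤-refl
ι≤1 (no _)  = z≤n

ι-× : (a : Dec A) (b : Dec B) → ι (a ×-dec b) ≡ ι a * ι b
ι-× (yes _) b = sym (+-identityʳ _)
ι-× (no _)  b = refl

ι-¬ : (a : Dec A) → ι a + ι (¬? a) ≡ 1
ι-¬ (yes _) = refl
ι-¬ (no _)  = refl

ι-positive : (a : Dec A) → 0 < ι a → A
ι-positive (yes a) _ = a

ι*-mono : (a : Dec A) {x y : ℕ} → (A → x ≤ y) → ι a * x ≤ ι a * y
ι*-mono (yes a) f = *-monoʳ-≤ 1 (f a)
ι*-mono (no _)  f = z≤n

ι*-positive : (a : Dec A) {x : ℕ} → 0 < ι a * x → A × 0 < x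
ι*-positive (yes a) p = a , subst (0 <_) (+-identityʳ _) p

-- Sums over all subsets.

∑ : (Subset n → ℕ) → ℕ
∑ {zero}  f = f []
∑ {suc n} f = ∑ (λ S → f (outside ∷ S)) + ∑ (λ S → f (inside ∷ S))

∑-mono : {f g : Subset n → ℕ} → (∀ S → f S ≤ g S) → ∑ f ≤ ∑ g
∑-mono {zero}  h = h []
∑-mono {suc n} h = +-mono-≤ (∑-mono (h ∘ (outside ∷_))) (∑-mono (h ∘ (inside ∷_)))

∑-cong : {f g : Subset n → ℕ} → (∀ S → f S ≡ g S) → ∑ f ≡ ∑ g
∑-cong {zero}  h = h []
∑-cong {suc n} h = cong₂ _+_ (∑-cong (h ∘ (outside ∷_))) (∑-cong (h ∘ (inside ∷_)))

∑-+ : (f g : Subset n → ℕ) → ∑ (λ S → f S + g S) ≡ ∑ f + ∑ g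
∑-+ {zero}  f g = refl
∑-+ {suc n} f g = trans (cong₂ _+_ (∑-+ (f ∘ (outside ∷_)) _) (∑-+ (f ∘ (inside ∷_)) _))
  (lemma (∑ (f ∘ (outside ∷_))) _ _ _)
  where
  lemma : ∀ a b c d → a + b + (c + d) ≡ a + c + (b + d)
  lemma = solve-∀

∑-* : (f : Subset n → ℕ) (c : ℕ) → ∑ (λ S → f S * c) ≡ ∑ f * c
∑-* {zero}  f c = refl
∑-* {suc n} f c = trans (cong₂ _+_ (∑-* (f ∘ (outside ∷_)) c) (∑-* (f ∘ (inside ∷_)) c))
  (sym (*-distribʳ-+ c (∑ (f ∘ (outside ∷_))) _))

∑-comm : ∀ {m} (f : Subset m → Subset n → ℕ) →
  ∑ (λ S → ∑ (λ T → f S T)) ≡ ∑ (λ T → ∑ (λ S → f S T))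
∑-comm {m = zero}  f = refl
∑-comm {m = suc m} f = trans (cong₂ _+_ (∑-comm (f ∘ (outside ∷_))) (∑-comm (f ∘ (inside ∷_))))
  (sym (∑-+ (λ T → ∑ (λ S → f (outside ∷ S) T)) _))

∑-∁ : (f : Subset n → ℕ) → ∑ (f ∘ ∁) ≡ ∑ f
∑-∁ {zero}  f = refl
∑-∁ {suc n} f = trans (cong₂ _+_ (∑-∁ (f ∘ (inside ∷_))) (∑-∁ (f ∘ (outside ∷_)))) (+-comm (∑ (f ∘ (inside ∷_))) _)

∑-zero : ∀ n → ∑ {n} (λ _ → 0) ≡ 0
∑-zero zero    = refl
∑-zero (suc n) = cong₂ _+_ (∑-zero n) (∑-zero n)

∑-positive : (f : Subset n → ℕ) → 0 < ∑ f → ∃ λ S → 0 < f S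
∑-positive {zero}  f p = [] , p
∑-positive {suc n} f p with ∑ (λ S → f (outside ∷ S)) in eq
... | zero  = let S , q = ∑-positive (f ∘ (inside ∷_)) p in inside ∷ S , q
... | suc _ = let S , q = ∑-positive (f ∘ (outside ∷_)) (subst (0 <_) (sym eq) z<s) in outside ∷ S , q

∑-≟ : (T : Subset n) → ∑ (λ S → ι (S ≟ₛ T)) ≡ 1
∑-≟ []            = refl
∑-≟ {suc n} (outside ∷ T) = cong₂ _+_ (∑-≟ T) (∑-zero n)
∑-≟ {suc n} (inside ∷ T)  = cong₂ _+_ (∑-zero n) (∑-≟ T)

-- A positive sum yields a witness `T`, and then the indicator of `P` is dominated by that of
-- equality with `T`.
∑-unique : {P : Pred (Subset n) 0ℓ} (P? : Decidable P) →
  (∀ {S T} → P S → P T → S ≡ T) → ∑ (λ S → ι (P? S)) ≤ 1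
∑-unique P? uniq with ∑ (λ S → ι (P? S)) in eq
... | zero  = z≤n
... | suc m = subst (_≤ 1) eq (≤-trans (∑-mono λ S → ι-mono (P? S) (S ≟ₛ T) λ p → uniq p (ι-positive (P? T) q))
                                       (≤-reflexive (∑-≟ T)))
  where
  T = proj₁ (∑-positive (λ S → ι (P? S)) (subst (0 <_) (sym eq) z<s))
  q = proj₂ (∑-positive (λ S → ι (P? S)) (subst (0 <_) (sym eq) z<s))

-- Opaque because `does (m ≟ k)` unfolds to `m ≡ᵇ k`, out of reach of with-abstraction.
opaque
  hasSize? : (k : ℕ) (S : Subset n) → Dec (∣ S ∣ ≡ k)
  hasSize? k S = ∣ S ∣ ≟ k

  hasSize≤? : (k : ℕ) (S : Subset n) → Dec (∣ S ∣ ≤ k)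
  hasSize≤? k S = ∣ S ∣ ≤? k

  ∑-hasSize : ∀ n k → ∑ {n} (λ S → ι (hasSize? k S)) ≡ n C k
  ∑-hasSize zero    zero    = refl
  ∑-hasSize zero    (suc k) = refl
  ∑-hasSize (suc n) zero    = cong₂ _+_ (∑-hasSize n 0) (∑-zero n)
  ∑-hasSize (suc n) (suc k) = trans (cong₂ _+_ (∑-hasSize n (suc k)) (∑-hasSize n k))
    (trans (+-comm (n C suc k) _) (nCk+nC[k+1]≡[n+1]C[k+1] n k))

-- The covering relation and its degrees.

infix 4 _⋖_ _⋖?_

data _⋖_ : Subset n → Subset n → Set where
  add  : {S : Subset n} → outside ∷ S ⋖ inside ∷ S
  keep : ∀ {s} {S T : Subset n} → S ⋖ T → s ∷ S ⋖ s ∷ T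

_⋖?_ : (S T : Subset n) → Dec (S ⋖ T)
[]            ⋖? []            = no λ ()
(outside ∷ S) ⋖? (outside ∷ T) = map′ keep (λ { (keep c) → c }) (S ⋖? T)
-- With this order `∑-covers` can apply `∑-≟` directly; only `∑-cocovers` has to flip it.
(outside ∷ S) ⋖? (inside ∷ T)  = map′ (λ { refl → add }) (λ { add → refl }) (T ≟ₛ S)
(inside ∷ S)  ⋖? (outside ∷ T) = no λ ()
(inside ∷ S)  ⋖? (inside ∷ T)  = map′ keep (λ { (keep c) → c }) (S ⋖? T)

⋖⇒⊆ : {S T : Subset n} → S ⋖ T → S ⊆ T
⋖⇒⊆ add      = out⊆ ⊆-refl
⋖⇒⊆ (keep c) = s⊆s (⋖⇒⊆ c)

⋖⇒∣∣ : {S T : Subset n} → S ⋖ T → ∣ T ∣ ≡ suc ∣ S ∣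
⋖⇒∣∣ add                  = refl
⋖⇒∣∣ (keep {s = outside} c) = ⋖⇒∣∣ c
⋖⇒∣∣ (keep {s = inside} c)  = cong suc (⋖⇒∣∣ c)

∑-covers : (S : Subset n) → ∑ (λ T → ι (S ⋖? T)) + ∣ S ∣ ≡ n
∑-covers []            = refl
∑-covers (outside ∷ S) = trans (cong (λ x → ∑ (λ T → ι (S ⋖? T)) + x + ∣ S ∣) (∑-≟ S))
  (trans (cong (_+ ∣ S ∣) (+-comm _ 1)) (cong suc (∑-covers S)))
∑-covers {suc n} (inside ∷ S)  = trans (cong (λ x → x + ∑ (λ T → ι (S ⋖? T)) + suc ∣ S ∣) (∑-zero n))
  (trans (+-suc _ ∣ S ∣) (cong suc (∑-covers S)))

∑-cocovers : (T : Subset n) → ∑ (λ S → ι (S ⋖? T)) ≡ ∣ T ∣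
∑-cocovers []            = refl
∑-cocovers {suc n} (outside ∷ T) = trans (cong₂ _+_ (∑-cocovers T) (∑-zero n)) (+-identityʳ _)
∑-cocovers (inside ∷ T)  = cong₂ _+_ (trans (∑-cong λ S → ι-cong (T ≟ₛ S) (S ≟ₛ T) sym sym) (∑-≟ T)) (∑-cocovers T)

⊆∧≤⇒≡ : {S T : Subset n} → S ⊆ T → ∣ T ∣ ≤ ∣ S ∣ → S ≡ T
⊆∧≤⇒≡ {S = []}          {[]}          _ _ = refl
⊆∧≤⇒≡ {S = outside ∷ S} {outside ∷ T} i l = cong (outside ∷_) (⊆∧≤⇒≡ (drop-∷-⊆ i) l)
⊆∧≤⇒≡ {S = inside ∷ S}  {inside ∷ T}  i l = cong (inside ∷_) (⊆∧≤⇒≡ (drop-∷-⊆ i) (s≤s⁻¹ l))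
⊆∧≤⇒≡ {S = outside ∷ S} {inside ∷ T}  i l = ⊥-elim (<-irrefl refl (≤-trans l (p⊆q⇒∣p∣≤∣q∣ (drop-∷-⊆ i))))
⊆∧≤⇒≡ {S = inside ∷ S}  {outside ∷ T} i l with () ← i here

⊆∧≢⇒< : {S T : Subset n} → S ⊆ T → S ≢ T → ∣ S ∣ < ∣ T ∣
⊆∧≢⇒< i ne = ≰⇒> λ l → ne (⊆∧≤⇒≡ i l)

⊆∧<⇒⊂ : {S T : Subset n} → S ⊆ T → ∣ S ∣ < ∣ T ∣ → S ⊂ T
⊆∧<⇒⊂ {S = []}          {[]}          _ ()
⊆∧<⇒⊂ {S = outside ∷ S} {outside ∷ T} i l = s⊂s (⊆∧<⇒⊂ (drop-∷-⊆ i) l)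
⊆∧<⇒⊂ {S = inside ∷ S}  {inside ∷ T}  i l = s⊂s (⊆∧<⇒⊂ (drop-∷-⊆ i) (s<s⁻¹ l))
⊆∧<⇒⊂ {S = outside ∷ S} {inside ∷ T}  i l = out⊂in (drop-∷-⊆ i)
⊆∧<⇒⊂ {S = inside ∷ S}  {outside ∷ T} i l with () ← i here

∁-involutive : (S : Subset n) → ∁ (∁ S) ≡ S
∁-involutive []            = refl
∁-involutive (outside ∷ S) = cong (outside ∷_) (∁-involutive S)
∁-involutive (inside ∷ S)  = cong (inside ∷_) (∁-involutive S)

∣S∣+∣∁S∣ : (S : Subset n) → ∣ S ∣ + ∣ ∁ S ∣ ≡ n
∣S∣+∣∁S∣ {n} S = trans (cong (∣ S ∣ +_) (∣∁p∣≡n∸∣p∣ S)) (m+[n∸m]≡n (∣p∣≤n S))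

-- Conditions (a) and (b), and the common denominators.

-- Positive forms of (a) and (b). Strict inclusion is split into `⊆` and a size inequality, which
-- survive complementation and the removal of an element.
UniqueAbove UniqueBelow : Pred (Subset n) 0ℓ → Set
UniqueAbove F = ∀ {A B E} → F A → F B → F E → A ⊆ B → A ⊆ E → ∣ A ∣ < ∣ B ∣ → ∣ B ∣ ≡ ∣ E ∣ → B ≡ E
UniqueBelow F = ∀ {A B E} → F A → F B → F E → B ⊆ A → E ⊆ A → ∣ B ∣ < ∣ A ∣ → ∣ B ∣ ≡ ∣ E ∣ → B ≡ E

-- The common denominator of the masses of the sets of size k; `mass` below is scaled by it.
scale : ℕ → ℕ → ℕ
scale n zero    = 1
scale n (suc k) = (n ∸ suc k) * scale n k

2k≤n⇒k≤n∸k : ∀ {n} k → 2 * k ≤ n → k ≤ n ∸ k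
2k≤n⇒k≤n∸k {n} k 2k≤n = m+n≤o⇒m≤o∸n k (subst (λ x → k + x ≤ n) (+-identityʳ k) 2k≤n)

scale-positive : ∀ k → 2 * k ≤ n → 0 < scale n k
scale-positive zero    _    = z<s
scale-positive (suc k) 2k≤n = *-mono-≤ (≤-trans z<s (2k≤n⇒k≤n∸k (suc k) 2k≤n))
  (scale-positive k (≤-trans (*-monoʳ-≤ 2 (n≤1+n k)) 2k≤n))

-- Pushing mass upwards.

module Pushing {n : ℕ} {F : Pred (Subset n) 0ℓ} (F? : Decidable F)
  (uniqueAbove : UniqueAbove F) (uniqueBelow : UniqueBelow F) where

  -- Meaningful for sets of size `k`. Passing from `scale n k` to `scale n (suc k)` absorbs the
  -- division by `n ∸ suc k`, so a nonmember receives a plain sum. A member receives nothing and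
  -- starts a fresh unit.
  mass : ℕ → Subset n → ℕ
  mass zero    D = ι (F? D)
  mass (suc k) D = if does (F? D) then scale n (suc k) else ∑ λ X → ι (X ⋖? D) * mass k X

  mass-member : ∀ k {D} → F D → mass k D ≡ scale n k
  mass-member zero    {D} f = ι-yes (F? D) f
  mass-member (suc k) {D} f rewrite dec-true (F? D) f = refl

  mass-nonmember : ∀ k {D} → ¬ F D → mass (suc k) D ≡ ∑ λ X → ι (X ⋖? D) * mass k X
  mass-nonmember k {D} ¬f rewrite dec-false (F? D) ¬f = refl

  -- Mass can be traced back down the covers to the member where it started.
  mass-positive : ∀ k {D} → 0 < mass k D → ∃ λ A → F A × A ⊆ D
  mass-positive zero    {D} p = D , ι-positive (F? D) p , ⊆-refl
  mass-positive (suc k) {D} p with F? D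
  ... | yes f = D , f , ⊆-refl
  ... | no ¬f =
    let X , q     = ∑-positive (λ X → ι (X ⋖? D) * mass k X) p
        c , r     = ι*-positive (X ⋖? D) q
        A , g , i = mass-positive k r
    in A , g , λ {x} → ⊆-trans i (⋖⇒⊆ c) {x}

  -- A nonmember of size `suc k` has `suc k` cocovers, each carrying at most a unit, and divides by
  -- `n ∸ suc k`, which is no smaller in the lower half.
  mass≤scale : ∀ k {D} → 2 * k ≤ n → ∣ D ∣ ≡ k → mass k D ≤ scale n k
  mass≤scale zero    {D} _ _ = ι≤1 (F? D)
  mass≤scale (suc k) {D} 2k≤n ∣D∣ with F? D
  ... | yes _ = ≤-refl
  ... | no _  = begin
    ∑ (λ X → ι (X ⋖? D) * mass k X)  ≤⟨ ∑-mono (λ X → ι*-mono (X ⋖? D) λ c →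
                                          mass≤scale k (≤-trans (*-monoʳ-≤ 2 (n≤1+n k)) 2k≤n)
                                            (suc-injective (trans (sym (⋖⇒∣∣ c)) ∣D∣))) ⟩
    ∑ (λ X → ι (X ⋖? D) * scale n k)   ≡⟨ ∑-* (λ X → ι (X ⋖? D)) (scale n k) ⟩
    ∑ (λ X → ι (X ⋖? D)) * scale n k   ≡⟨ cong (_* scale n k) (trans (∑-cocovers D) ∣D∣) ⟩
    suc k * scale n k                  ≤⟨ *-monoˡ-≤ (scale n k) (2k≤n⇒k≤n∸k (suc k) 2k≤n) ⟩
    (n ∸ suc k) * scale n k            ∎
    where open ≤-Reasoning

  level upto total : ℕ → ℕ
  level k = ∑ λ D → ι (hasSize? k D) * ι (F? D)
  upto  k = ∑ λ D → ι (hasSize≤? k D) * ι (F? D)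
  total k = ∑ λ D → ι (hasSize? k D) * mass k D

  upto-suc : ∀ k → upto (suc k) ≤ level (suc k) + upto k
  upto-suc k = ≤-trans (∑-mono pointwise) (≤-reflexive (∑-+ (λ D → ι (hasSize? (suc k) D) * ι (F? D)) _))
    where
    pointwise : ∀ D → ι (hasSize≤? (suc k) D) * ι (F? D)
                    ≤ ι (hasSize? (suc k) D) * ι (F? D) + ι (hasSize≤? k D) * ι (F? D)
    pointwise D = ≤-trans (*-monoˡ-≤ (ι (F? D)) split) (≤-reflexive (*-distribʳ-+ (ι (F? D)) (ι (hasSize? (suc k) D)) _))
      where
      split : ι (hasSize≤? (suc k) D) ≤ ι (hasSize? (suc k) D) + ι (hasSize≤? k D)
      split with hasSize? (suc k) D
      ... | yes _ = ≤-trans (ι≤1 (hasSize≤? (suc k) D)) (m≤m+n 1 _)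
      ... | no ne = ι-mono (hasSize≤? (suc k) D) (hasSize≤? k D) λ l → s≤s⁻¹ (≤∧≢⇒< l ne)

  -- The size factor makes the mass received vanish off level `suc k` once the sums are exchanged in
  -- `total-suc`.
  newCovers : ℕ → Subset n → ℕ
  newCovers k X = ∑ λ D → ι (X ⋖? D) * (ι (hasSize? (suc k) D) * ι (¬? (F? D)))

  -- The mass of `X` comes from a member `A` below it. All covers of `X` have one size and contain
  -- `A`, so by (a) at most one of the `n ∸ k` covers is a member.
  newCovers-≥ : ∀ k {X} → ∣ X ∣ ≡ k → 0 < mass k X → n ∸ suc k ≤ newCovers k X
  newCovers-≥ k {X} ∣X∣ pos = m≤n+o⇒m∸n≤o n (suc k) (begin
    n                                                   ≡⟨ ∑-covers X ⟨
    ∑ (λ D → ι (X ⋖? D)) + ∣ X ∣                        ≤⟨ +-mono-≤ (∑-mono pointwise) (≤-reflexive ∣X∣) ⟩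
    ∑ (λ D → ι ((X ⋖? D) ×-dec F? D) + _) + k           ≡⟨ cong (_+ k) (∑-+ (λ D → ι ((X ⋖? D) ×-dec F? D)) _) ⟩
    ∑ (λ D → ι ((X ⋖? D) ×-dec F? D)) + newCovers k X + k
      ≤⟨ +-monoˡ-≤ k (+-monoˡ-≤ (newCovers k X) (∑-unique (λ D → (X ⋖? D) ×-dec F? D) unique)) ⟩
    1 + newCovers k X + k                               ≡⟨ cong suc (+-comm _ k) ⟩
    suc k + newCovers k X                               ∎)
    where
    open ≤-Reasoning
    unique : ∀ {D E} → X ⋖ D × F D → X ⋖ E × F E → D ≡ E
    unique {D} {E} (c , f) (d , g) =
      let A , h , i = mass-positive k pos
      in uniqueAbove h f g (λ {x} → ⊆-trans i (⋖⇒⊆ c) {x}) (λ {x} → ⊆-trans i (⋖⇒⊆ d) {x})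
           (≤-trans (s≤s (p⊆q⇒∣p∣≤∣q∣ i)) (≤-reflexive (sym (⋖⇒∣∣ c))))
           (trans (⋖⇒∣∣ c) (sym (⋖⇒∣∣ d)))
    pointwise : ∀ D → ι (X ⋖? D) ≤ ι ((X ⋖? D) ×-dec F? D) + ι (X ⋖? D) * (ι (hasSize? (suc k) D) * ι (¬? (F? D)))
    pointwise D with X ⋖? D
    ... | no _  = z≤n
    ... | yes c = ≤-reflexive (sym (trans
      (cong (λ x → ι (F? D) + (x * ι (¬? (F? D)) + 0))
            (ι-yes (hasSize? (suc k) D) (trans (⋖⇒∣∣ c) (cong suc ∣X∣))))
      (trans (cong (ι (F? D) +_) (trans (+-identityʳ _) (*-identityˡ _))) (ι-¬ (F? D)))))

  -- No mass is lost: double counting along the covering pairs from level `k` to nonmembers on level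
  -- `suc k`, with a fresh unit for each new member.
  total-suc : ∀ k → level (suc k) * scale n (suc k) + total k * (n ∸ suc k) ≤ total (suc k)
  total-suc k = begin
    level (suc k) * scale n (suc k) + total k * (n ∸ suc k)
      ≡⟨ cong₂ _+_ (sym (∑-* (λ D → ι (hasSize? (suc k) D) * ι (F? D)) (scale n (suc k))))
                   (sym (∑-* (λ X → ι (hasSize? k X) * mass k X) (n ∸ suc k))) ⟩
    members + ∑ (λ X → ι (hasSize? k X) * mass k X * (n ∸ suc k))
      ≤⟨ +-monoʳ-≤ members (∑-mono pushed) ⟩
    members + ∑ (λ X → newCovers k X * mass k X)
      ≡⟨ cong (members +_) (trans (∑-cong λ X → sym (∑-* (newCover X) (mass k X)))
                                  (∑-comm λ X D → newCover X D * mass k X)) ⟩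
    members + ∑ received
      ≡⟨ ∑-+ (λ D → ι (hasSize? (suc k) D) * ι (F? D) * scale n (suc k)) received ⟨
    ∑ (λ D → ι (hasSize? (suc k) D) * ι (F? D) * scale n (suc k) + received D)
      ≤⟨ ∑-mono pointwise ⟩
    total (suc k) ∎
    where
    open ≤-Reasoning
    members : ℕ
    members = ∑ λ D → ι (hasSize? (suc k) D) * ι (F? D) * scale n (suc k)
    newCover : Subset n → Subset n → ℕ
    newCover X D = ι (X ⋖? D) * (ι (hasSize? (suc k) D) * ι (¬? (F? D)))
    received : Subset n → ℕ
    received D = ∑ λ X → newCover X D * mass k X

    pushed : ∀ X → ι (hasSize? k X) * mass k X * (n ∸ suc k) ≤ newCovers k X * mass k X
    -- Only a set with positive mass is known to have enough new covers; otherwise the left side is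
    -- zero.
    pushed X with hasSize? k X | mass k X in eq
    ... | no _    | _     = z≤n
    ... | yes ∣X∣ | zero  = z≤n
    ... | yes ∣X∣ | suc r = begin
      (suc r + 0) * (n ∸ suc k) ≡⟨ cong (_* (n ∸ suc k)) (+-identityʳ (suc r)) ⟩
      suc r * (n ∸ suc k)       ≤⟨ *-monoʳ-≤ (suc r) (newCovers-≥ k ∣X∣ (subst (0 <_) (sym eq) z<s)) ⟩
      suc r * newCovers k X     ≡⟨ *-comm (suc r) _ ⟩
      newCovers k X * suc r     ∎

    pointwise : ∀ D → ι (hasSize? (suc k) D) * ι (F? D) * scale n (suc k) + received D
                    ≤ ι (hasSize? (suc k) D) * mass (suc k) D
    pointwise D with hasSize? (suc k) D | F? D
    ... | no _  | _     = ≤-reflexive (trans (∑-cong λ X → cong (_* mass k X) (*-zeroʳ (ι (X ⋖? D)))) (∑-zero n))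
    ... | yes _ | yes _ = ≤-reflexive (trans (cong (scale n (suc k) + 0 +_)
                            (trans (∑-cong λ X → cong (_* mass k X) (*-zeroʳ (ι (X ⋖? D)))) (∑-zero n)))
                            (+-identityʳ _))
    ... | yes _ | no _  = ≤-reflexive (trans (∑-cong λ X → cong (_* mass k X) (*-identityʳ (ι (X ⋖? D))))
                                             (sym (+-identityʳ _)))

  upto≤total : ∀ k → upto k * scale n k ≤ total k
  upto≤total zero    = ≤-trans (≤-reflexive (*-identityʳ (upto 0)))
    (∑-mono λ D → *-monoˡ-≤ (ι (F? D)) (ι-mono (hasSize≤? 0 D) (hasSize? 0 D) n≤0⇒n≡0))
  upto≤total (suc k) = begin
    upto (suc k) * scale n (suc k)                                   ≤⟨ *-monoˡ-≤ (scale n (suc k)) (upto-suc k) ⟩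
    (level (suc k) + upto k) * scale n (suc k)                       ≡⟨ rearrange (level (suc k)) (upto k) (n ∸ suc k) (scale n k) ⟩
    level (suc k) * scale n (suc k) + upto k * scale n k * (n ∸ suc k) ≤⟨ +-monoʳ-≤ _ (*-monoˡ-≤ (n ∸ suc k) (upto≤total k)) ⟩
    level (suc k) * scale n (suc k) + total k * (n ∸ suc k)          ≤⟨ total-suc k ⟩
    total (suc k)                                                  ∎
    where
    open ≤-Reasoning
    rearrange : ∀ l u d s → (l + u) * (d * s) ≡ l * (d * s) + u * s * d
    rearrange = solve-∀

  -- The bound of one half for nonmembers below a member.

  Dominated : Subset n → Set
  Dominated D = ∃ λ E → F E × D ⊆ E × ∣ D ∣ < ∣ E ∣

  dominated-⋖ : ∀ {X D} → X ⋖ D → Dominated D → Dominated X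
  dominated-⋖ {X} {D} c (E , f , i , l) =
    E , f , (λ {x} → ⊆-trans (⋖⇒⊆ c) i {x}) , ≤-trans (s≤s (p⊆q⇒∣p∣≤∣q∣ (⋖⇒⊆ c))) l

  -- Member cocovers of `D` have equal size and lie below the member `E` above `D`, so (b)
  -- identifies them.
  memberCocovers≤1 : ∀ {D} → Dominated D → ∑ (λ X → ι (X ⋖? D) * ι (F? X)) ≤ 1
  memberCocovers≤1 {D} dom@(E , f , i , l) = ≤-trans
    (≤-reflexive (∑-cong λ X → sym (ι-× (X ⋖? D) (F? X))))
    (∑-unique (λ X → (X ⋖? D) ×-dec F? X) λ (c , g) (d , h) →
      uniqueBelow f g h (λ {x} → ⊆-trans (⋖⇒⊆ c) i {x}) (λ {x} → ⊆-trans (⋖⇒⊆ d) i {x})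
        (≤-trans (s≤s (p⊆q⇒∣p∣≤∣q∣ (⋖⇒⊆ c))) l)
        (suc-injective (trans (sym (⋖⇒∣∣ c)) (⋖⇒∣∣ d))))

  module _ (⊥∉F : ¬ F ⊥) where

    -- The only cocover is the empty set, which carries no mass.
    mass-1 : ∀ {D} → ∣ D ∣ ≡ 1 → ¬ F D → mass 1 D ≡ 0
    mass-1 {D} ∣D∣ ¬f = trans (mass-nonmember 0 ¬f) (n≤0⇒n≡0 (≤-trans
      (∑-mono λ X → ≤-trans (ι*-mono (X ⋖? D) λ c → ≤-reflexive (ι-no (F? X) λ f →
         ⊥∉F (subst F (sym (⊆∧≤⇒≡ ⊥⊆ (≤-trans (≤-reflexive (suc-injective (trans (sym (⋖⇒∣∣ c)) ∣D∣))) z≤n))) f)))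
         (≤-reflexive (*-zeroʳ (ι (X ⋖? D)))))
      (≤-reflexive (∑-zero n))))

    -- The bound k / (2 (k + 1)) on the unscaled mass is what makes the induction close: one cocover
    -- of mass 1 and k + 1 of mass k / (2 (k + 1)) give total (k + 2) / 2 to be divided by n − k − 2.
    mutual
      mass-dominated : ∀ k {D} → 2 * (k + 2) ≤ n → ∣ D ∣ ≡ suc k → ¬ F D → Dominated D →
        suc k * (2 * mass (suc k) D) ≤ k * scale n (suc k)
      mass-dominated zero    _ ∣D∣ ¬f dom = ≤-reflexive (cong (λ x → 1 * (2 * x)) (mass-1 ∣D∣ ¬f))
      mass-dominated (suc j) {D} bound ∣D∣ ¬f dom = begin
        (2 + j) * (2 * mass (2 + j) D)          ≤⟨ *-monoʳ-≤ (2 + j) (mass-dominated′ j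
                                                     (≤-trans (*-monoʳ-≤ 2 (n≤1+n (j + 2))) bound) ∣D∣ ¬f dom) ⟩
        (2 + j) * ((2 + j) * scale n (suc j))     ≡⟨ *-assoc (2 + j) (2 + j) (scale n (suc j)) ⟨
        (2 + j) * (2 + j) * scale n (suc j)       ≤⟨ *-monoˡ-≤ (scale n (suc j))
                                                       (m+n≤o⇒m≤o ((2 + j) * (2 + j)) (≤-reflexive (square j))) ⟩
        (1 + j) * (4 + j) * scale n (suc j)       ≤⟨ *-monoˡ-≤ (scale n (suc j)) (*-monoʳ-≤ (1 + j) gap) ⟩
        (1 + j) * (n ∸ (2 + j)) * scale n (suc j) ≡⟨ *-assoc (1 + j) (n ∸ (2 + j)) (scale n (suc j)) ⟩
        (1 + j) * scale n (2 + j)                 ∎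
        where
        open ≤-Reasoning
        -- The slack is exactly `j`, so the induction is tight at `j = 0`.
        square : ∀ j → (2 + j) * (2 + j) + j ≡ (1 + j) * (4 + j)
        square = solve-∀
        double : ∀ j → 4 + j + (2 + j) ≡ 2 * (suc j + 2)
        double = solve-∀
        gap : 4 + j ≤ n ∸ (2 + j)
        gap = m+n≤o⇒m≤o∸n (4 + j) (≤-trans (≤-reflexive (double j)) bound)

      -- Stated before the division by `n ∸ (2 + k)`, since that divisor differs for the two uses:
      -- at least `4 + k` below the middle, exactly `2 + k` in the middle.
      mass-dominated′ : ∀ k {D} → 2 * (k + 2) ≤ n → ∣ D ∣ ≡ 2 + k → ¬ F D → Dominated D →
        2 * mass (2 + k) D ≤ (2 + k) * scale n (suc k)
      mass-dominated′ k {D} bound ∣D∣ ¬f dom = *-cancelˡ-≤ (suc k) (begin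
        suc k * (2 * mass (2 + k) D)
          ≡⟨ cong (λ x → suc k * (2 * x)) (mass-nonmember (suc k) ¬f) ⟩
        suc k * (2 * ∑ (λ X → ι (X ⋖? D) * mass (suc k) X))
          ≡⟨ rearrange₁ (suc k) (∑ λ X → ι (X ⋖? D) * mass (suc k) X) ⟩
        ∑ (λ X → ι (X ⋖? D) * mass (suc k) X) * (suc k * 2)
          ≡⟨ ∑-* (λ X → ι (X ⋖? D) * mass (suc k) X) (suc k * 2) ⟨
        ∑ (λ X → ι (X ⋖? D) * mass (suc k) X * (suc k * 2))
          ≤⟨ ∑-mono pointwise ⟩
        -- Every cocover is charged `k * S`, the inductive bound for nonmembers. A member carries
        -- `2 * suc k` times `S`, hence the surcharge `2 + k`, paid at most once.
        ∑ (λ X → ι (X ⋖? D) * (k * S) + ι (X ⋖? D) * ι (F? X) * ((2 + k) * S))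
          ≡⟨ trans (∑-+ (λ X → ι (X ⋖? D) * (k * S)) _)
               (cong₂ _+_ (∑-* (λ X → ι (X ⋖? D)) (k * S)) (∑-* (λ X → ι (X ⋖? D) * ι (F? X)) ((2 + k) * S))) ⟩
        ∑ (λ X → ι (X ⋖? D)) * (k * S) + ∑ (λ X → ι (X ⋖? D) * ι (F? X)) * ((2 + k) * S)
          ≤⟨ +-mono-≤ (≤-reflexive (cong (_* (k * S)) (trans (∑-cocovers D) ∣D∣)))
               (*-monoˡ-≤ ((2 + k) * S) (memberCocovers≤1 dom)) ⟩
        (2 + k) * (k * S) + 1 * ((2 + k) * S)
          ≡⟨ rearrange₂ k S ⟩
        suc k * ((2 + k) * S) ∎)
        where
        open ≤-Reasoning
        S : ℕ
        S = scale n (suc k)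
        rearrange₁ : ∀ a x → a * (2 * x) ≡ x * (a * 2)
        rearrange₁ = solve-∀
        rearrange₂ : ∀ k s → (2 + k) * (k * s) + 1 * ((2 + k) * s) ≡ suc k * ((2 + k) * s)
        rearrange₂ = solve-∀
        rearrange₃ : ∀ m k → (m + 0) * (suc k * 2) ≡ suc k * (2 * m)
        rearrange₃ = solve-∀
        pointwise : ∀ X → ι (X ⋖? D) * mass (suc k) X * (suc k * 2)
                        ≤ ι (X ⋖? D) * (k * S) + ι (X ⋖? D) * ι (F? X) * ((2 + k) * S)
        pointwise X with X ⋖? D
        ... | no _  = z≤n
        ... | yes c = subst (_≤ 1 * (k * S) + 1 * ι (F? X) * ((2 + k) * S))
                        (sym (rearrange₃ (mass (suc k) X) k)) (helper (F? X))
          where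
          helper : (f? : Dec (F X)) →
            suc k * (2 * mass (suc k) X) ≤ 1 * (k * S) + 1 * ι f? * ((2 + k) * S)
          helper (yes f) = ≤-reflexive (trans (cong (λ x → suc k * (2 * x)) (mass-member (suc k) f)) (rearrange₄ k S))
            where
            rearrange₄ : ∀ k s → suc k * (2 * s) ≡ 1 * (k * s) + 1 * 1 * ((2 + k) * s)
            rearrange₄ = solve-∀
          helper (no ¬g) = ≤-trans
            (mass-dominated k bound (suc-injective (trans (sym (⋖⇒∣∣ c)) ∣D∣)) ¬g (dominated-⋖ c dom))
            (≤-reflexive (sym (trans (+-identityʳ _) (+-identityʳ _))))

    -- The factor `2 + j` from `mass-dominated′` cancels against the equal divisor and leaves half a
    -- unit. In sizes 0 and 1 a nonmember has no mass at all.
    mass-middle : ∀ k {D} → 2 * k ≡ n → ∣ D ∣ ≡ k → ¬ F D → Dominated D → 2 * mass k D ≤ scale n k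
    mass-middle zero {D} _ _ ¬f _ = ≤-trans (≤-reflexive (cong (2 *_) (ι-no (F? D) ¬f))) z≤n
    mass-middle (suc zero) _ ∣D∣ ¬f _ = ≤-trans (≤-reflexive (cong (2 *_) (mass-1 ∣D∣ ¬f))) z≤n
    mass-middle (suc (suc j)) {D} eq ∣D∣ ¬f dom = begin
      2 * mass (2 + j) D               ≤⟨ mass-dominated′ j (≤-reflexive (trans (cong (2 *_) (+-comm j 2)) eq)) ∣D∣ ¬f dom ⟩
      (2 + j) * scale n (suc j)          ≡⟨ cong (_* scale n (suc j)) gap ⟨
      (n ∸ (2 + j)) * scale n (suc j)    ∎
      where
      open ≤-Reasoning
      gap : n ∸ (2 + j) ≡ 2 + j
      gap = trans (cong (_∸ (2 + j)) (sym eq))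
        (trans (m+n∸m≡n (2 + j) (2 + j + 0)) (+-identityʳ (2 + j)))

-- Duality under complementation.

∁-injective : {S T : Subset n} → ∁ S ≡ ∁ T → S ≡ T
∁-injective {S = S} {T} eq = trans (sym (∁-involutive S)) (trans (cong ∁ eq) (∁-involutive T))

∁-size-< : {S T : Subset n} → S ⊆ T → ∣ S ∣ < ∣ T ∣ → ∣ ∁ T ∣ < ∣ ∁ S ∣
∁-size-< i l = p⊂q⇒∣p∣<∣q∣ (p⊂q⇒∁p⊃∁q (⊆∧<⇒⊂ i l))

∁-size-≡ : (S T : Subset n) → ∣ S ∣ ≡ ∣ T ∣ → ∣ ∁ S ∣ ≡ ∣ ∁ T ∣
∁-size-≡ {n} S T eq = trans (∣∁p∣≡n∸∣p∣ S) (trans (cong (n ∸_) eq) (sym (∣∁p∣≡n∸∣p∣ T)))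

∁⊤≡⊥ : ∀ n → ∁ (⊤ {n}) ≡ ⊥
∁⊤≡⊥ zero    = refl
∁⊤≡⊥ (suc n) = cong (outside ∷_) (∁⊤≡⊥ n)

∁⊥≡⊤ : ∀ n → ∁ (⊥ {n}) ≡ ⊤
∁⊥≡⊤ n = trans (cong ∁ (sym (∁⊤≡⊥ n))) (∁-involutive ⊤)

-- Complementation reverses inclusions and preserves equality of sizes, so it exchanges (a) and (b).
uniqueAbove-∁ : {F : Pred (Subset n) 0ℓ} → UniqueBelow F → UniqueAbove (F ∘ ∁)
uniqueAbove-∁ ub {B = B} {E} f g h i j l eq =
  ∁-injective (ub f g h (p⊆q⇒∁p⊇∁q i) (p⊆q⇒∁p⊇∁q j) (∁-size-< i l) (∁-size-≡ B E eq))

uniqueBelow-∁ : {F : Pred (Subset n) 0ℓ} → UniqueAbove F → UniqueBelow (F ∘ ∁)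
uniqueBelow-∁ ua {B = B} {E} f g h i j l eq =
  ∁-injective (ua f g h (p⊆q⇒∁p⊇∁q i) (p⊆q⇒∁p⊇∁q j) (∁-size-< i l) (∁-size-≡ B E eq))

count : {F : Pred (Subset n) 0ℓ} → Decidable F → ℕ
count F? = ∑ λ S → ι (F? S)

-- Comparison on the middle level for `n = 2m`.

module Middle {n : ℕ} {F : Pred (Subset n) 0ℓ} (F? : Decidable F)
  (uniqueAbove : UniqueAbove F) (uniqueBelow : UniqueBelow F)
  (⊥∉F : ¬ F ⊥) (⊤∉F : ¬ F ⊤) (m : ℕ) (2m≡n : 2 * m ≡ n) where

  open Pushing F? uniqueAbove uniqueBelow
  -- Pushing down is pushing up in the complemented family: `Co.mass m (∁ D)` is the mass that
  -- reaches `D` from above.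
  module Co = Pushing (F? ∘ ∁) (uniqueAbove-∁ uniqueBelow) (uniqueBelow-∁ uniqueAbove)

  ∣∁∣-middle : ∀ D → ∣ D ∣ ≡ m → ∣ ∁ D ∣ ≡ m
  ∣∁∣-middle D ∣D∣ = trans (∣∁p∣≡n∸∣p∣ D) (trans (cong₂ _∸_ (sym 2m≡n) ∣D∣)
    (trans (m+n∸m≡n m (m + 0)) (+-identityʳ m)))

  -- If one side sends nothing, the other is at most a unit by `mass≤scale`. If both send something,
  -- `D` lies strictly between two members and each side is at most one half.
  load-nonmember : ∀ {D} → ∣ D ∣ ≡ m → ¬ F D → mass m D + Co.mass m (∁ D) ≤ scale n m
  load-nonmember {D} ∣D∣ ¬f with mass m D in eq | Co.mass m (∁ D) in eq′
  ... | zero  | y     = subst (_≤ scale n m) eq′ (Co.mass≤scale m (≤-reflexive 2m≡n) (∣∁∣-middle D ∣D∣))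
  ... | suc x | zero  = subst (_≤ scale n m) (trans eq (sym (+-identityʳ (suc x))))
                          (mass≤scale m (≤-reflexive 2m≡n) ∣D∣)
  ... | suc x | suc y = *-cancelˡ-≤ 2 (begin
    2 * (suc x + suc y)     ≡⟨ *-distribˡ-+ 2 (suc x) (suc y) ⟩
    2 * suc x + 2 * suc y   ≡⟨ cong₂ (λ a b → 2 * a + 2 * b) eq eq′ ⟨
    2 * mass m D + 2 * Co.mass m (∁ D)
      ≤⟨ +-mono-≤ (mass-middle ⊥∉F m 2m≡n ∣D∣ ¬f dominated)
           (Co.mass-middle (⊤∉F ∘ subst F (∁⊥≡⊤ n)) m 2m≡n (∣∁∣-middle D ∣D∣) 
              (¬f ∘ subst F (∁-involutive D)) codominated) ⟩
    scale n m + scale n m   ≡⟨ cong (scale n m +_) (+-identityʳ (scale n m)) ⟨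
    2 * scale n m           ∎)
    where
    open ≤-Reasoning
    -- Mass from above traces back to a member containing `D`, strictly since `D` is no member.
    dominated : Dominated D
    dominated =
      let A , f , i = Co.mass-positive m {∁ D} (subst (0 <_) (sym eq′) z<s)
          D⊆ : D ⊆ ∁ A
          D⊆ = subst (_⊆ ∁ A) (∁-involutive D) (p⊆q⇒∁p⊇∁q i)
      in ∁ A , f , (λ {x} → D⊆ {x}) , ⊆∧≢⇒< D⊆ λ e → ¬f (subst F (sym e) f)
    codominated : Co.Dominated (∁ D)
    codominated =
      let A , f , i = mass-positive m {D} (subst (0 <_) (sym eq) z<s)
          ∁D⊆ : ∁ D ⊆ ∁ A
          ∁D⊆ = p⊆q⇒∁p⊇∁q i
      in ∁ A , subst F (sym (∁-involutive A)) f , (λ {x} → ∁D⊆ {x}) ,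
         ⊆∧≢⇒< ∁D⊆ λ e → ¬f (subst F (sym (∁-injective e)) f)

  -- A middle member starts a unit in both directions, so it has capacity two; the second unit is
  -- matched by `level m` in `count+level≤`.
  load : ∀ D → ι (hasSize? m D) * mass m D + ι (hasSize? m (∁ D)) * Co.mass m (∁ D)
             ≤ (ι (hasSize? m D) + ι (hasSize? m D) * ι (F? D)) * scale n m
  load D rewrite ι-cong (hasSize? m (∁ D)) (hasSize? m D)
                   (λ s → subst (λ S → ∣ S ∣ ≡ m) (∁-involutive D) (∣∁∣-middle (∁ D) s)) (∣∁∣-middle D)
    with hasSize? m D | F? D
  ... | no _    | _     = z≤n
  ... | yes ∣D∣ | no ¬f = subst₂ _≤_ (sym (cong₂ _+_ (+-identityʳ (mass m D)) (+-identityʳ (Co.mass m (∁ D)))))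
                            (sym (+-identityʳ (scale n m))) (load-nonmember ∣D∣ ¬f)
  ... | yes ∣D∣ | yes f = subst₂ _≤_ (sym (cong₂ _+_ (+-identityʳ (mass m D)) (+-identityʳ (Co.mass m (∁ D)))))
                            refl (+-mono-≤ (≤-reflexive (mass-member m f))
                              (≤-reflexive (trans (Co.mass-member m (subst F (sym (∁-involutive D)) f))
                                                  (sym (+-identityʳ _)))))

  -- Every set has size at most `m` or a complement of size at most `m`, and the middle sets have
  -- both.
  count+level≤ : count F? + level m ≤ upto m + Co.upto m
  count+level≤ = begin
    count F? + level m
      ≡⟨ ∑-+ (λ D → ι (F? D)) (λ D → ι (hasSize? m D) * ι (F? D)) ⟨
    ∑ (λ D → ι (F? D) + ι (hasSize? m D) * ι (F? D))
      ≤⟨ ∑-mono pointwise ⟩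
    ∑ (λ D → ι (hasSize≤? m D) * ι (F? D) + ι (hasSize≤? m (∁ D)) * ι (F? (∁ (∁ D))))
      ≡⟨ ∑-+ (λ D → ι (hasSize≤? m D) * ι (F? D)) (λ D → ι (hasSize≤? m (∁ D)) * ι (F? (∁ (∁ D)))) ⟩
    upto m + ∑ (λ D → ι (hasSize≤? m (∁ D)) * ι (F? (∁ (∁ D))))
      ≡⟨ cong (upto m +_) (∑-∁ (λ D → ι (hasSize≤? m D) * ι (F? (∁ D)))) ⟩
    upto m + Co.upto m ∎
    where
    open ≤-Reasoning
    sizes : ∀ D → 1 + ι (hasSize? m D) ≤ ι (hasSize≤? m D) + ι (hasSize≤? m (∁ D))
    sizes D with hasSize? m D | hasSize≤? m D | hasSize≤? m (∁ D)
    ... | yes _ | yes _ | yes _ = ≤-refl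
    ... | yes p | no q  | _     = ⊥-elim (q (≤-reflexive p))
    ... | yes p | _     | no q  = ⊥-elim (q (≤-reflexive (∣∁∣-middle D p)))
    ... | no _  | yes _ | _     = s≤s z≤n
    ... | no _  | no _  | yes _ = ≤-refl
    ... | no _  | no p  | no q  = ⊥-elim (<-irrefl (trans 2m≡n (sym (∣S∣+∣∁S∣ D))) (begin-strict
      2 * m             ≡⟨ cong (m +_) (+-identityʳ m) ⟩
      m + m             <⟨ +-mono-< (≰⇒> p) (≰⇒> q) ⟩
      ∣ D ∣ + ∣ ∁ D ∣   ∎))
    pointwise : ∀ D → ι (F? D) + ι (hasSize? m D) * ι (F? D)
                    ≤ ι (hasSize≤? m D) * ι (F? D) + ι (hasSize≤? m (∁ D)) * ι (F? (∁ (∁ D)))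
    pointwise D rewrite ∁-involutive D = ≤-trans (*-monoˡ-≤ (ι (F? D)) (sizes D))
      (≤-reflexive (*-distribʳ-+ (ι (F? D)) (ι (hasSize≤? m D)) _))

  -- The units conserved in both directions are compared with the capacities in `load`; `level m`
  -- stands on both sides and cancels, as does the positive scale.
  count≤ : count F? ≤ n C m
  count≤ = +-cancelʳ-≤ (level m) _ _ (≤-trans count+level≤ (*-cancelʳ-≤ _ _ (scale n m)
    {{>-nonZero (scale-positive m (≤-reflexive 2m≡n))}} (begin
    (upto m + Co.upto m) * scale n m
      ≡⟨ *-distribʳ-+ (scale n m) (upto m) _ ⟩
    upto m * scale n m + Co.upto m * scale n m
      ≤⟨ +-mono-≤ (upto≤total m) (Co.upto≤total m) ⟩
    total m + Co.total m
      ≡⟨ cong (total m +_) (∑-∁ (λ D → ι (hasSize? m D) * Co.mass m D)) ⟨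
    total m + ∑ (λ D → ι (hasSize? m (∁ D)) * Co.mass m (∁ D))
      ≡⟨ ∑-+ (λ D → ι (hasSize? m D) * mass m D) (λ D → ι (hasSize? m (∁ D)) * Co.mass m (∁ D)) ⟨
    ∑ (λ D → ι (hasSize? m D) * mass m D + ι (hasSize? m (∁ D)) * Co.mass m (∁ D))
      ≤⟨ ∑-mono load ⟩
    ∑ (λ D → (ι (hasSize? m D) + ι (hasSize? m D) * ι (F? D)) * scale n m)
      ≡⟨ ∑-* (λ D → ι (hasSize? m D) + ι (hasSize? m D) * ι (F? D)) (scale n m) ⟩
    ∑ (λ D → ι (hasSize? m D) + ι (hasSize? m D) * ι (F? D)) * scale n m
      ≡⟨ cong (_* scale n m) (trans
           (∑-+ (λ D → ι (hasSize? m D)) (λ D → ι (hasSize? m D) * ι (F? D)))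
           (cong (_+ level m) (∑-hasSize n m))) ⟩
    (n C m + level m) * scale n m ∎)))
    where open ≤-Reasoning

-- Families containing the empty or the full set.

module _ {n : ℕ} {F : Pred (Subset n) 0ℓ} (F? : Decidable F)
  (uniqueAbove : UniqueAbove F) (uniqueBelow : UniqueBelow F) where

  count-∁ : count (F? ∘ ∁) ≡ count F?
  count-∁ = ∑-∁ (λ S → ι (F? S))

  -- By (b) below the full set, every level has at most one member. Level 0 is kept as `ι (F? ⊥)`:
  -- when the empty set is absent, the bound `n` rather than `suc n` is what fits under C(2,1) for
  -- `n = 2`.
  count-⊤∈F : F ⊤ → count F? ≤ n + ι (F? ⊥)
  count-⊤∈F f = ≤-trans (∑-mono λ S → ≤-trans (≤-reflexive (sym (+-identityʳ _)))
      (*-monoˡ-≤ (ι (F? S)) (≤-reflexive (sym (ι-yes (hasSize≤? n S) (∣p∣≤n S))))))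
    (upto≤ n)
    where
    open Pushing F? uniqueAbove uniqueBelow
    open ≤-Reasoning

    level≤1 : ∀ k → level k ≤ 1
    level≤1 k = ≤-trans (≤-reflexive (∑-cong λ S → sym (ι-× (hasSize? k S) (F? S))))
      (∑-unique (λ S → hasSize? k S ×-dec F? S) unique)
      where
      unique : ∀ {S T} → ∣ S ∣ ≡ k × F S → ∣ T ∣ ≡ k × F T → S ≡ T
      -- Condition (b) needs sets strictly below the full set; on level `n` there is only one set
      -- anyway.
      unique {S} {T} (p , g) (q , h) with ∣ S ∣ <? n
      ... | yes l = uniqueBelow f g h ⊆⊤ ⊆⊤ (subst (∣ S ∣ <_) (sym (∣⊤∣≡n n)) l) (trans p (sym q))
      ... | no l  = trans (∣p∣≡n⇒p≡⊤ ∣S∣) (sym (∣p∣≡n⇒p≡⊤ (trans q (trans (sym p) ∣S∣))))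
        where
        ∣S∣ : ∣ S ∣ ≡ n
        ∣S∣ = ≤-antisym (∣p∣≤n S) (≮⇒≥ l)

    upto≤ : ∀ k → upto k ≤ k + ι (F? ⊥)
    upto≤ zero = begin
      upto 0                                 ≤⟨ ∑-mono pointwise ⟩
      ∑ (λ S → ι (S ≟ₛ ⊥ {n}) * ι (F? ⊥))        ≡⟨ ∑-* (λ S → ι (S ≟ₛ ⊥ {n})) (ι (F? ⊥)) ⟩
      ∑ (λ S → ι (S ≟ₛ ⊥ {n})) * ι (F? ⊥)        ≡⟨ cong (_* ι (F? ⊥)) (∑-≟ (⊥ {n})) ⟩
      1 * ι (F? ⊥)                           ≡⟨ *-identityˡ (ι (F? ⊥)) ⟩
      ι (F? ⊥)                               ∎
      where
      pointwise : ∀ S → ι (hasSize≤? 0 S) * ι (F? S) ≤ ι (S ≟ₛ ⊥ {n}) * ι (F? ⊥)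
      pointwise S with S ≟ₛ ⊥
      ... | yes refl = *-monoˡ-≤ (ι (F? ⊥)) (ι≤1 (hasSize≤? 0 (⊥ {n})))
      ... | no S≢⊥   = ≤-reflexive (cong (_* ι (F? S)) (ι-no (hasSize≤? 0 S)
                         λ l → S≢⊥ (sym (⊆∧≤⇒≡ ⊥⊆ (≤-trans l z≤n)))))
    upto≤ (suc k) = ≤-trans (upto-suc k) (+-mono-≤ (level≤1 (suc k)) (upto≤ k))

-- Estimates for central binomial coefficients.

-- Both terms of Pascal's rule for C(2m+2, m+1) contain C(2m, m), by Pascal's rule once more.
2*C[2m,m]≤C[2m+2,m+1] : ∀ m → 2 * ((2 * m) C m) ≤ (2 * suc m) C suc m
2*C[2m,m]≤C[2m+2,m+1] m = begin
  2 * ((2 * m) C m)                             ≡⟨ cong ((2 * m) C m +_) (+-identityʳ _) ⟩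
  (2 * m) C m + (2 * m) C m                     ≤⟨ +-monoʳ-≤ _ (≤-trans (m≤m+n _ ((2 * m) C suc m))
                                                     (≤-reflexive (nCk+nC[k+1]≡[n+1]C[k+1] (2 * m) m))) ⟩
  (2 * m) C m + suc (2 * m) C suc m             ≤⟨ +-monoˡ-≤ (suc (2 * m) C suc m) (C≤ m) ⟩
  suc (2 * m) C m + suc (2 * m) C suc m         ≡⟨ nCk+nC[k+1]≡[n+1]C[k+1] (suc (2 * m)) m ⟩
  suc (suc (2 * m)) C suc m                     ≡⟨ cong (_C suc m) (*-suc 2 m) ⟨
  (2 * suc m) C suc m                           ∎
  where
  open ≤-Reasoning
  C≤ : ∀ m → (2 * m) C m ≤ suc (2 * m) C m
  C≤ zero    = ≤-refl
  C≤ (suc j) = ≤-trans (m≤n+m _ ((2 * suc j) C j)) (≤-reflexive (nCk+nC[k+1]≡[n+1]C[k+1] (2 * suc j) j))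

-- Induction from 4 < 6; at `m = 1` both sides are 2. Strictness leaves room for the `suc n` of
-- `count-extreme`.
2m<C[2m,m] : ∀ j → 2 * (2 + j) < (2 * (2 + j)) C (2 + j)
2m<C[2m,m] zero    = n≤1+n 5
2m<C[2m,m] (suc j) = begin-strict
  2 * (3 + j)                       <⟨ m<m+n (2 * (3 + j)) {2 + 2 * j} z<s ⟩
  2 * (3 + j) + (2 + 2 * j)         ≡⟨ double j ⟩
  2 * (2 * (2 + j))                 ≤⟨ *-monoʳ-≤ 2 (<⇒≤ (2m<C[2m,m] j)) ⟩
  2 * ((2 * (2 + j)) C (2 + j))     ≤⟨ 2*C[2m,m]≤C[2m+2,m+1] (2 + j) ⟩
  (2 * (3 + j)) C (3 + j)           ∎
  where
  open ≤-Reasoning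
  double : ∀ j → 2 * (3 + j) + (2 + 2 * j) ≡ 2 * (2 * (2 + j))
  double = solve-∀

2m≤C[2m,m] : ∀ j → 2 * suc j ≤ (2 * suc j) C suc j
2m≤C[2m,m] zero    = ≤-refl
2m≤C[2m,m] (suc j) = <⇒≤ (2m<C[2m,m] j)

2m+2≤2*C[2m,m] : ∀ j → 2 + 2 * suc j ≤ 2 * ((2 * suc j) C suc j)
2m+2≤2*C[2m,m] j = begin
  2 + 2 * suc j               ≡⟨ *-suc 2 (suc j) ⟨
  2 * (1 + suc j)             ≤⟨ *-monoʳ-≤ 2 (+-monoˡ-≤ (suc j) (s≤s (z≤n {j}))) ⟩
  2 * (suc j + suc j)         ≡⟨ cong (λ x → 2 * (suc j + x)) (+-identityʳ (suc j)) ⟨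
  2 * (2 * suc j)             ≤⟨ *-monoʳ-≤ 2 (2m≤C[2m,m] j) ⟩
  2 * ((2 * suc j) C suc j)   ∎
  where open ≤-Reasoning

-- The two terms of Pascal's rule agree by symmetry. This brings the bound for even `n` into the
-- form of the theorem.
C[2m+2,m+1]≡2*C[2m+1,m] : ∀ m → (2 * suc m) C suc m ≡ 2 * (suc (2 * m) C m)
C[2m+2,m+1]≡2*C[2m+1,m] m = begin
  (2 * suc m) C suc m                   ≡⟨ cong (_C suc m) (*-suc 2 m) ⟩
  suc (suc (2 * m)) C suc m             ≡⟨ nCk+nC[k+1]≡[n+1]C[k+1] (suc (2 * m)) m ⟨
  suc (2 * m) C m + suc (2 * m) C suc m ≡⟨ cong (suc (2 * m) C m +_) (trans (nCk≡nC[n∸k] (s≤s (m≤m+n m (m + 0))))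
                                             (trans (cong (suc (2 * m) C_) (trans (m+n∸m≡n m (m + 0)) (+-identityʳ m)))
                                                    (sym (+-identityʳ _)))) ⟩
  2 * (suc (2 * m) C m)                 ∎
  where open ≡-Reasoning

-- Even and odd ground sets.

count-⊥∉F : ∀ j {F : Pred (Subset (2 * suc j)) 0ℓ} (F? : Decidable F) → UniqueAbove F → UniqueBelow F →
  ¬ F ⊥ → count F? ≤ (2 * suc j) C suc j
count-⊥∉F j F? ua ub ¬f with F? ⊤
... | yes f = ≤-trans (count-⊤∈F F? ua ub f)
                (≤-trans (≤-reflexive (trans (cong (2 * suc j +_) (ι-no (F? ⊥) ¬f)) (+-identityʳ _))) (2m≤C[2m,m] j))
... | no ¬g = Middle.count≤ F? ua ub ¬f ¬g (suc j) refl

count-⊤∉F : ∀ j {F : Pred (Subset (2 * suc j)) 0ℓ} (F? : Decidable F) → UniqueAbove F → UniqueBelow F →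
  ¬ F ⊤ → count F? ≤ (2 * suc j) C suc j
count-⊤∉F j {F} F? ua ub ¬f = subst (_≤ (2 * suc j) C suc j) (count-∁ F? ua ub)
  (count-⊥∉F j (F? ∘ ∁) (uniqueAbove-∁ ub) (uniqueBelow-∁ ua) (¬f ∘ subst F (∁⊥≡⊤ (2 * suc j))))

count-extreme : {F : Pred (Subset n) 0ℓ} (F? : Decidable F) → UniqueAbove F → UniqueBelow F →
  F ⊥ ⊎ F ⊤ → count F? ≤ suc n
count-extreme {n} F? ua ub (inj₂ f) = ≤-trans (count-⊤∈F F? ua ub f)
  (≤-trans (+-monoʳ-≤ n (ι≤1 (F? ⊥))) (≤-reflexive (+-comm n 1)))
count-extreme {n} {F} F? ua ub (inj₁ f) = subst (_≤ suc n) (count-∁ F? ua ub)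
  (≤-trans (count-⊤∈F (F? ∘ ∁) (uniqueAbove-∁ ub) (uniqueBelow-∁ ua) (subst F (sym (∁⊤≡⊥ n)) f))
    (≤-trans (+-monoʳ-≤ n (ι≤1 (F? (∁ ⊥)))) (≤-reflexive (+-comm n 1))))

uniqueAbove-∷ : ∀ s {F : Pred (Subset (suc n)) 0ℓ} → UniqueAbove F → UniqueAbove (F ∘ (s ∷_))
uniqueAbove-∷ outside ua f g h i j l eq with refl ← ua f g h (s⊆s i) (s⊆s j) l eq = refl
uniqueAbove-∷ inside  ua f g h i j l eq with refl ← ua f g h (s⊆s i) (s⊆s j) (s<s l) (cong suc eq) = refl

uniqueBelow-∷ : ∀ s {F : Pred (Subset (suc n)) 0ℓ} → UniqueBelow F → UniqueBelow (F ∘ (s ∷_))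
uniqueBelow-∷ outside ub f g h i j l eq with refl ← ub f g h (s⊆s i) (s⊆s j) l eq = refl
uniqueBelow-∷ inside  ub f g h i j l eq with refl ← ub f g h (s⊆s i) (s⊆s j) (s<s l) (cong suc eq) = refl

-- The index starts at `m = 2`: for `n = 2` a full chain has three members, but C(2,1) is 2.
count-even : ∀ j {F : Pred (Subset (2 * (2 + j))) 0ℓ} (F? : Decidable F) → UniqueAbove F → UniqueBelow F →
  count F? ≤ (2 * (2 + j)) C (2 + j)
count-even j F? ua ub with F? ⊥
... | yes f = ≤-trans (count-extreme F? ua ub (inj₁ f)) (2m<C[2m,m] j)
... | no ¬f = count-⊥∉F (suc j) F? ua ub ¬f

count-odd : ∀ j {F : Pred (Subset (suc (2 * suc j))) 0ℓ} (F? : Decidable F) → UniqueAbove F → UniqueBelow F →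
  count F? ≤ 2 * ((2 * suc j) C suc j)
count-odd j {F} F? ua ub with F? ⊥ | F? ⊤
... | yes f | _     = ≤-trans (count-extreme F? ua ub (inj₁ f)) (2m+2≤2*C[2m,m] j)
... | no _  | yes f = ≤-trans (count-extreme F? ua ub (inj₂ f)) (2m+2≤2*C[2m,m] j)
-- The empty set lies in the `outside` half and the full set in the `inside` half, so each half
-- inherits one of the two exclusions.
... | no ¬f | no ¬g = ≤-trans
  (+-mono-≤ (count-⊥∉F j (F? ∘ (outside ∷_)) (uniqueAbove-∷ outside ua) (uniqueBelow-∷ outside ub) ¬f)
            (count-⊤∉F j (F? ∘ (inside ∷_)) (uniqueAbove-∷ inside ua) (uniqueBelow-∷ inside ub) ¬g))
  (≤-reflexive (cong ((2 * suc j) C suc j +_) (sym (+-identityʳ _))))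

even-or-odd : ∀ n → ∃ λ m → n ≡ 2 * m ⊎ n ≡ suc (2 * m)
even-or-odd zero = 0 , inj₁ refl
even-or-odd (suc n) with even-or-odd n
... | m , inj₁ eq = m , inj₂ (cong suc eq)
... | m , inj₂ eq = suc m , inj₁ (trans (cong suc eq) (sym (*-suc 2 m)))

⌊2m/2⌋≡m : ∀ m → ⌊ 2 * m /2⌋ ≡ m
⌊2m/2⌋≡m m = trans (cong (λ x → ⌊ m + x /2⌋) (+-identityʳ m)) (sym (n≡⌊n+n/2⌋ m))

⌊1+2m/2⌋≡m : ∀ m → ⌊ suc (2 * m) /2⌋ ≡ m
⌊1+2m/2⌋≡m zero    = refl
⌊1+2m/2⌋≡m (suc m) = trans (cong (λ x → ⌊ suc x /2⌋) (*-suc 2 m)) (cong suc (⌊1+2m/2⌋≡m m))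

count-bound : ∀ n → 3 ≤ n → {F : Pred (Subset n) 0ℓ} (F? : Decidable F) → UniqueAbove F → UniqueBelow F →
  count F? ≤ 2 * ((n ∸ 1) C ⌊ n ∸ 1 /2⌋)
count-bound n 3≤n F? ua ub with even-or-odd n
count-bound _ (s≤s (s≤s ())) F? ua ub | suc zero , inj₁ refl
count-bound _ 3≤n F? ua ub | suc (suc j) , inj₁ refl = ≤-trans (count-even j F? ua ub)
  (≤-reflexive (trans (C[2m+2,m+1]≡2*C[2m+1,m] (suc j)) (cong (2 *_) (cong₂ _C_ pred≡
    (trans (sym (⌊1+2m/2⌋≡m (suc j))) (cong ⌊_/2⌋ pred≡))))))
  where
  pred≡ : suc (2 * suc j) ≡ 2 * (2 + j) ∸ 1
  pred≡ = cong (_∸ 1) (sym (*-suc 2 (suc j)))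
count-bound _ (s≤s ()) F? ua ub | zero , inj₂ refl
count-bound _ 3≤n F? ua ub | suc j , inj₂ refl = subst (λ x → count F? ≤ 2 * ((2 * suc j) C x))
  (sym (⌊2m/2⌋≡m (suc j))) (count-odd j F? ua ub)

-- From duplicate-free lists to counts.

module _ {n : ℕ} where
  open DecMembership (_≟ₛ_ {n}) using (_∈?_)

  length≤count : (F : List (Subset n)) → Unique F → length F ≤ count (_∈? F)
  length≤count []      _          = z≤n
  length≤count (T ∷ F) (T∉F ∷ uF) = begin
    suc (length F)                              ≤⟨ s≤s (length≤count F uF) ⟩
    1 + count (_∈? F)                           ≡⟨ cong (_+ count (_∈? F)) (∑-≟ T) ⟨
    ∑ (λ S → ι (S ≟ₛ T)) + count (_∈? F)        ≡⟨ ∑-+ (λ S → ι (S ≟ₛ T)) (λ S → ι (S ∈? F)) ⟨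
    ∑ (λ S → ι (S ≟ₛ T) + ι (S ∈? F))           ≤⟨ ∑-mono pointwise ⟩
    count (_∈? (T ∷ F))                         ∎
    where
    open ≤-Reasoning
    pointwise : ∀ S → ι (S ≟ₛ T) + ι (S ∈? F) ≤ ι (S ∈? (T ∷ F))
    pointwise S with S ≟ₛ T
    -- Here `Unique` enters: the head does not recur in the tail, so it is counted once.
    ... | yes refl = ≤-reflexive (cong suc (ι-no (S ∈? F) λ m → lookup T∉F m refl))
    ... | no _     = ι-mono (S ∈? F) (S ∈? F) λ m → m

  uniqueAbove-NoForbidden : (F : List (Subset n)) → NoForbidden F → UniqueAbove (_∈ F)
  uniqueAbove-NoForbidden F nf {A} {B} {E} a b c i j l eq with B ≟ₛ E
  ... | yes B≡E = B≡E
  ... | no B≢E  = ⊥-elim (nf a b c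
    ((λ { refl → <-irrefl refl l }) , (λ { refl → <-irrefl (sym eq) l }) , B≢E ,
     inj₁ (⊆∧<⇒⊂ i l , ⊆∧<⇒⊂ j (subst (∣ A ∣ <_) eq l) , eq)))

  uniqueBelow-NoForbidden : (F : List (Subset n)) → NoForbidden F → UniqueBelow (_∈ F)
  uniqueBelow-NoForbidden F nf {A} {B} {E} a b c i j l eq with B ≟ₛ E
  ... | yes B≡E = B≡E
  ... | no B≢E  = ⊥-elim (nf a b c
    ((λ { refl → <-irrefl refl l }) , (λ { refl → <-irrefl eq l }) , B≢E ,
     inj₂ (⊆∧<⇒⊂ i l , ⊆∧<⇒⊂ j (subst (_< ∣ A ∣) eq l) , eq)))

theorem2p4 : (n : ℕ) → 3 ≤ n → (F : List (Subset n)) → Unique F → NoForbidden F →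
    length F ≤ 2 * ((n ∸ 1) C ⌊ n ∸ 1 /2⌋)
theorem2p4 n 3≤n F uF nf = ≤-trans (length≤count F uF)
  (count-bound n 3≤n (λ S → DecMembership._∈?_ _≟ₛ_ S F) (uniqueAbove-NoForbidden F nf) (uniqueBelow-NoForbidden F nf))
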